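{- Let $k\ge1$, $n_1=2k+1$, let $G$ be an Abelian group of order $n_1$, and let $\{\{0\},E_1,E_2\}$ be an $(n_1,(1,k,k),k-1)$-PDF over $G$ with $|E_1|=|E_2|=k$. Let $\mathcal{W}=\{W_1,W_2,W_3\}$ be the family of disjoint subsets of $\mathbb{Z}_2\times G$ given by $W_1=\{(1,0)\}$, $W_2=\{0\}\times E_1$, $W_3=\{0\}\times E_2$. Then $\mathcal{W}$ is an optimal $(n=2n_1,\ 3,\ (1,k,k),\ 2k+1,\ k+1)$-BSWEDF.
   Context: PDF: a family $\{B_1,\dots,B_m\}$ of subsets of an Abelian group $G$ of order $n$ that partitions $G$, with $K=(|B_1|,\dots,|B_m|)$, is an $(n,K,\lambda)$-partitioned difference family (PDF) if each nonzero element of $G$ appears exactly $\lambda$ times in the multi-set union of the multi-sets $\{x-y: x,y\in B_i,\ x\ne y\}$, $1\le i\le m$. BSWEDF: for multi-sets $B_1,B_2$ of elements of an Abelian group $G$ of order $n$, $D(B_1,B_2)$ is the multi-set $\{x-y : x\in B_1,\ y\in B_2\}$; $k\boxtimes B$ is the multi-set in which each element of $B$ is repeated $k$ times; unions are multi-set unions. Let $\mathcal{B}=\{B_i : 1\le i\le m\}$ be a family of pairwise disjoint nonempty subsets of $G$, $k_i=|B_i|$, $K=(k_1,\dots,k_m)$, $a=\sum_i k_i$, $\widetilde{k}=\mathrm{lcm}(k_1,\dots,k_m)$, $\widetilde{B}_i=\frac{\widetilde{k}}{k_i}\boxtimes B_i$. Then $\mathcal{B}$ is an $(n,m,K,a,\lambda)$-BSWEDF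 if $\lambda$ is the smallest positive integer such that $\bigcup_{1\le i\ne j\le m}D(B_i,\widetilde{B}_j)\subseteq\lambda\boxtimes(G\setminus\{0\})$. It is optimal if $\lambda$ takes the smallest possible value among all BSWEDFs (over Abelian groups of order $n$) with the given $n,m,K$. -}

module Defs where

open import Algebra.Bundles using (AbelianGroup)
open import Algebra.Construct.DirectProduct using (abelianGroup)
open import Data.Fin.Base using (Fin)
open import Data.Fin.Patterns using (0F; 1F)
open import Data.Fin.Properties as Fin using (*↔×)
open import Data.List.Base
  using (List; map; concatMap; filter; length; replicate; allFin;
         cartesianProduct; cartesianProductWith)
open import Data.Nat.Base using (ℕ; _+_; _*_; _≤_; _/_; NonZero)
open import Data.Nat.LCM using (lcm)
open import Data.Parity.Base using (Parity; 0ℙ; 1ℙ)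
open import Data.Parity.Properties using (+-0-abelianGroup)
open import Data.Product.Base using (∃-syntax; _,_; uncurry)
open import Data.Product.Function.NonDependent.Setoid using (_×-inverse_)
open import Data.Product.Relation.Binary.Pointwise.NonDependent using (Pointwise-≡↔≡)
open import Data.Vec.Functional using (Vector; foldr)
open import Function.Bundles using (Inverse; mk↔ₛ′)
open import Function.Construct.Composition using (inverse)
open import Function.Properties.Inverse using (Inverse⇒Injection) renaming (sym to Inverse-sym)
open import Level using (Level; Setω; 0ℓ; _⊔_)
open import Relation.Binary.Definitions using (Decidable)
open import Relation.Binary.PropositionalEquality as ≡ using (_≡_; _≢_; refl)
open import Relation.Nullary.Decidable using (¬?; via-injection)
import Data.List.Membership.Setoid as Membership
import Data.List.Relation.Binary.Disjoint.Setoid as Disjointness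
import Data.List.Relation.Unary.Unique.Setoid as Uniqueness

private
  variable
    c ℓ : Level

HasOrder : AbelianGroup c ℓ → ℕ → Set (c ⊔ ℓ)
HasOrder G n = Inverse (≡.setoid (Fin n)) (AbelianGroup.setoid G)

sum : ∀ {m} → Vector ℕ m → ℕ
sum = foldr _+_ 0

lcmAll : ∀ {m} → Vector ℕ m → ℕ
lcmAll = foldr lcm 1

-- Multi-sets of elements of G are lists, considered only through the
-- multiplicities of their elements; subsets of G are lists without
-- repetitions (up to the equality of G).
module Multisets (G : AbelianGroup c ℓ) (n : ℕ) (ord : HasOrder G n) where

  open AbelianGroup G using (Carrier; _≈_; ε; _-_; setoid) public

  _≈?_ : Decidable _≈_
  _≈?_ = via-injection (Inverse⇒Injection (Inverse-sym ord)) Fin._≟_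

  multiplicity : Carrier → List Carrier → ℕ
  multiplicity x A = length (filter (x ≈?_) A)

  infix 4 _⊑_
  _⊑_ : List Carrier → List Carrier → Set c
  A ⊑ B = ∀ x → multiplicity x A ≤ multiplicity x B

  infixr 7 _⊠_
  _⊠_ : ℕ → List Carrier → List Carrier
  k ⊠ B = concatMap (replicate k) B

  D : List Carrier → List Carrier → List Carrier
  D = cartesianProductWith _-_

  G∖0 : List Carrier
  G∖0 = filter (λ x → ¬? (x ≈? ε)) (map (Inverse.to ord) (allFin n))

  -- The multi-set {x - y : x, y ∈ B, x ≠ y}.
  internalDifferences : List Carrier → List Carrier
  internalDifferences B =
    map (uncurry _-_) (filter (λ (x , y) → ¬? (x ≈? y)) (cartesianProduct B B))

  sizes : ∀ {m} → (Fin m → List Carrier) → Vector ℕ m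
  sizes B i = length (B i)

  -- B̃ᵢ = (k̃ / kᵢ) ⊠ Bᵢ with k̃ = lcm (k₁ , … , kₘ).
  weighted : ∀ {m} (B : Fin m → List Carrier) →
             (∀ i → NonZero (sizes B i)) → Fin m → List Carrier
  weighted B nonempty i =
    (lcmAll (sizes B) / sizes B i) {{nonempty i}} ⊠ B i

  weightedExternalDifferences : ∀ {m} (B : Fin m → List Carrier) →
                                (∀ i → NonZero (sizes B i)) → List Carrier
  weightedExternalDifferences {m} B nonempty =
    concatMap (λ (i , j) → D (B i) (weighted B nonempty j))
      (filter (λ (i , j) → ¬? (i Fin.≟ j)) (cartesianProduct (allFin m) (allFin m)))

record DisjointNonemptySubsets (G : AbelianGroup c ℓ) (m : ℕ)
         (B : Fin m → List (AbelianGroup.Carrier G)) : Set (c ⊔ ℓ) where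
  open AbelianGroup G using (setoid)
  field
    unique   : ∀ i → Uniqueness.Unique setoid (B i)
    disjoint : ∀ i j → i ≢ j → Disjointness.Disjoint setoid (B i) (B j)
    nonempty : ∀ i → NonZero (length (B i))

record IsPDF (G : AbelianGroup c ℓ) (n : ℕ) (ord : HasOrder G n)
         {m : ℕ} (K : Vector ℕ m) (lam : ℕ)
         (B : Fin m → List (AbelianGroup.Carrier G)) : Set (c ⊔ ℓ) where
  open Multisets G n ord
  open Membership setoid using (_∈_)
  field
    subsets     : DisjointNonemptySubsets G m B
    covers      : ∀ x → ∃[ i ] x ∈ B i
    size        : ∀ i → sizes B i ≡ K i
    differences : ∀ x → AbelianGroup._≉_ G x ε →
                  multiplicity x (concatMap (λ i → internalDifferences (B i)) (allFin m)) ≡ lam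

record IsBSWEDF (G : AbelianGroup c ℓ) (n : ℕ) (ord : HasOrder G n)
         (m : ℕ) (K : Vector ℕ m) (a lam : ℕ)
         (B : Fin m → List (AbelianGroup.Carrier G)) : Set (c ⊔ ℓ) where
  open Multisets G n ord
  field
    subsets : DisjointNonemptySubsets G m B
  open DisjointNonemptySubsets subsets public
  field
    size     : ∀ i → sizes B i ≡ K i
    total    : a ≡ sum K
    positive : 1 ≤ lam
    bound    : weightedExternalDifferences B nonempty ⊑ lam ⊠ G∖0
    smallest : ∀ μ → 1 ≤ μ →
               weightedExternalDifferences B nonempty ⊑ μ ⊠ G∖0 → lam ≤ μ

-- In Setω because the competing families range over Abelian groups in
-- every universe.
record IsOptimalBSWEDF (G : AbelianGroup c ℓ) (n : ℕ) (ord : HasOrder G n)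
         (m : ℕ) (K : Vector ℕ m) (a lam : ℕ)
         (B : Fin m → List (AbelianGroup.Carrier G)) : Setω where
  field
    isBSWEDF : IsBSWEDF G n ord m K a lam B
    optimal  : ∀ {c′ ℓ′} (H : AbelianGroup c′ ℓ′) (ordH : HasOrder H n)
               (C : Fin m → List (AbelianGroup.Carrier H)) (a′ μ : ℕ) →
               IsBSWEDF H n ordH m K a′ μ C → lam ≤ μ

ℤ₂ : AbelianGroup 0ℓ 0ℓ
ℤ₂ = +-0-abelianGroup

ℤ₂×_ : AbelianGroup c ℓ → AbelianGroup c ℓ
ℤ₂× G = abelianGroup ℤ₂ G

ℤ₂-order : HasOrder ℤ₂ 2
ℤ₂-order = mk↔ₛ′ (λ { 0F → 0ℙ ; 1F → 1ℙ }) (λ { 0ℙ → 0F ; 1ℙ → 1F })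
                 (λ { 0ℙ → refl ; 1ℙ → refl }) (λ { 0F → refl ; 1F → refl })

ℤ₂×-order : (G : AbelianGroup c ℓ) {n : ℕ} → HasOrder G n → HasOrder (ℤ₂× G) (2 * n)
ℤ₂×-order G ord =
  inverse *↔× (inverse (Inverse-sym Pointwise-≡↔≡) (ℤ₂-order ×-inverse ord))

{-# OPTIONS --safe #-}

-- Every element of G has multiplicity |A| in D(A, G) and in D(G, A). Writing
-- G = {0} ∪ E₁ ∪ E₂ and subtracting the internal differences of the PDF, each
-- x ≠ 0 occurs exactly k times in D(E₁, E₂) ∪ D(E₂, E₁); these are the
-- differences of 𝒲 in the layer {0} × G. The layer {1} × G receives x at most
-- once from D(W₁, W₂ ∪ W₃) and at most k times from the reversed pairs, so
-- λ = k + 1 suffices. No smaller λ is possible for any family with these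
-- sizes, because its 4k² + 2k weighted differences exceed k (|H| - 1) = k (4k + 1).
module Submission where

open import Defs
open import Algebra.Bundles using (AbelianGroup)
open import Data.Fin.Base using (Fin)
import Data.Fin.Properties as Fin
open import Data.Fin.Patterns using (0F; 1F; 2F)
open import Data.List.Base
  using (List; [_]; map; _++_; concatMap; filter; length;
         replicate; allFin; cartesianProduct; cartesianProductWith)
open import Data.List.Properties
  using (length-++; length-map; length-replicate; length-tabulate;
         filter-++; filter-none; filter-notAll; filter-some; filter-accept; filter-reject;
         map-++; map-∘; cartesianProductWith-zeroʳ)
open import Data.List.Relation.Unary.All as All using (All)
open import Data.List.Relation.Unary.All.Properties using (¬Any⇒All¬)
open import Data.List.Relation.Unary.Any as Any using (here)
import Data.List.Relation.Unary.Any.Properties as Any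
open import Data.Nat.Base
  using (ℕ; zero; suc; _+_; _*_; _∸_; _/_; _≤_; _<_; _≥_; z≤n; s≤s; s≤s⁻¹; NonZero; >-nonZero⁻¹)
open import Data.Nat.Divisibility using (_∣_; ∣-antisym; ∣-refl; ∣-trans; 1∣_)
open import Data.Nat.DivMod using (m/n*n≡m; n/1≡n; n/n≡1)
open import Data.Nat.LCM using (m∣lcm[m,n]; n∣lcm[m,n]; lcm-least)
open import Data.Nat.ListAction using () renaming (sum to sumᴸ)
open import Data.Nat.Properties
open import Data.Nat.Solver using (module +-*-Solver)
open import Data.Parity.Base using (Parity; 0ℙ; 1ℙ)
open import Data.Product.Base using (_×_; _,_; proj₁; proj₂; uncurry)
open import Data.Vec.Functional as Vec using (Vector)
open import Data.Sum.Base using (inj₁; inj₂)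
open import Function.Base using (_∘_; case_of_)
open import Function.Bundles using (Injection; Inverse)
open import Function.Properties.Inverse using (Inverse⇒Injection)
open import Level using (Level)
open import Relation.Binary.PropositionalEquality as ≡
  using (_≡_; _≢_; refl; sym; trans; cong; cong₂; subst; module ≡-Reasoning)
open import Relation.Nullary using (¬_; yes; no; contradiction)
open import Relation.Nullary.Decidable using (¬?)
open import Relation.Unary using (Pred; Decidable)
import Algebra.Properties.AbelianGroup as AbelianGroupProperties
import Data.List.Membership.Setoid as Membership
import Data.List.Membership.Setoid.Properties as Membershipₚ
import Data.List.Membership.Propositional.Properties as ∈ₚ
import Data.List.Relation.Unary.Unique.Setoid as Uniqueness
import Data.List.Relation.Unary.Unique.Setoid.Properties as Uniqueₚ
import Data.List.Relation.Unary.Unique.Propositional.Properties as Unique≡ₚ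

private
  variable
    a b c ℓ p q : Level
    A : Set a
    B : Set b
    C : Set c

-- Lengths of filtered, mapped and concatenated lists.

module ListProperties where

  open import Data.List.Base using ([]; _∷_)

  length-filter-map : {P : Pred A p} {Q : Pred B q} (P? : Decidable P) (Q? : Decidable Q)
    (f : A → B) → (∀ x → Q (f x) → P x) → (∀ x → P x → Q (f x)) →
    ∀ xs → length (filter Q? (map f xs)) ≡ length (filter P? xs)
  length-filter-map P? Q? f to from [] = refl
  length-filter-map P? Q? f to from (x ∷ xs) with P? x | Q? (f x)
  ... | yes _  | yes _  = cong suc (length-filter-map P? Q? f to from xs)
  ... | no  _  | no  _  = length-filter-map P? Q? f to from xs
  ... | yes px | no ¬qx = contradiction (from x px) ¬qx
  ... | no ¬px | yes qx = contradiction (to x qx) ¬px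

  -- An entry discarded by `P?` would be rejected by `Q?` after mapping anyway.
  length-filter-map-filter : {P : Pred A p} {Q : Pred B q} (P? : Decidable P) (Q? : Decidable Q)
    (f : A → B) → (∀ x → Q (f x) → P x) →
    ∀ xs → length (filter Q? (map f (filter P? xs))) ≡ length (filter Q? (map f xs))
  length-filter-map-filter P? Q? f to [] = refl
  length-filter-map-filter P? Q? f to (x ∷ xs) with P? x
  ... | no ¬px = trans (length-filter-map-filter P? Q? f to xs)
                       (cong length (sym (filter-reject Q? (¬px ∘ to x))))
  ... | yes _ with Q? (f x)
  ...   | yes _ = cong suc (length-filter-map-filter P? Q? f to xs)
  ...   | no  _ = length-filter-map-filter P? Q? f to xs

  map-uncurry-cartesianProduct : (f : A → B → C) → ∀ xs ys →
    map (uncurry f) (cartesianProduct xs ys) ≡ cartesianProductWith f xs ys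
  map-uncurry-cartesianProduct f []       ys = refl
  map-uncurry-cartesianProduct f (x ∷ xs) ys = trans
    (map-++ (uncurry f) (map (x ,_) ys) (cartesianProduct xs ys))
    (cong₂ _++_ (sym (map-∘ ys)) (map-uncurry-cartesianProduct f xs ys))

  length-cartesianProductWith : (f : A → B → C) → ∀ xs ys →
    length (cartesianProductWith f xs ys) ≡ length xs * length ys
  length-cartesianProductWith f []       ys = refl
  length-cartesianProductWith f (x ∷ xs) ys = trans
    (length-++ (map (f x) ys))
    (cong₂ _+_ (length-map (f x) ys) (length-cartesianProductWith f xs ys))

  length-concatMap : (f : A → List B) → ∀ xs →
    length (concatMap f xs) ≡ sumᴸ (map (length ∘ f) xs)
  length-concatMap f []       = refl
  length-concatMap f (x ∷ xs) =
    trans (length-++ (f x)) (cong (length (f x) +_) (length-concatMap f xs))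

  length-concatMap-replicate : ∀ m (xs : List A) →
    length (concatMap (replicate m) xs) ≡ m * length xs
  length-concatMap-replicate m []       = sym (*-zeroʳ m)
  length-concatMap-replicate m (x ∷ xs) = begin
    length (replicate m x ++ concatMap (replicate m) xs)  ≡⟨ length-++ (replicate m x) ⟩
    length (replicate m x) + length (concatMap (replicate m) xs)
      ≡⟨ cong₂ _+_ (length-replicate m) (length-concatMap-replicate m xs) ⟩
    m + m * length xs  ≡⟨ *-suc m (length xs) ⟨
    m * suc (length xs)  ∎
    where open ≡-Reasoning

-- The sizes `(1, k, k)` and their least common multiple.

1kk : ℕ → Vector ℕ 3
1kk k = 1 Vec.∷ k Vec.∷ k Vec.∷ Vec.[]

-- It evaluates to (0,1), (0,2), (1,0), (1,2), (2,0), (2,1); later sums over pairs of blocks unfold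
-- in this order.
offDiagonal : List (Fin 3 × Fin 3)
offDiagonal = filter (λ (i , j) → ¬? (i Fin.≟ j)) (cartesianProduct (allFin 3) (allFin 3))

-- Plain congruence is blocked because the `NonZero` instance depends on the divisor. Once the
-- divisors are identified, the two instances agree by irrelevance.
quotient-cong : ∀ {m n d e} .{{_ : NonZero d}} .{{_ : NonZero e}} →
                m ≡ n → d ≡ e → m / d ≡ n / e
quotient-cong refl refl = refl

-- Every entry divides `k`, and `k` is itself an entry, so the two sides divide each other.
lcmAll-1kk : ∀ {k} (S : Vector ℕ 3) → (∀ i → S i ≡ 1kk k i) → lcmAll S ≡ k
lcmAll-1kk {k} S eq rewrite eq 0F | eq 1F | eq 2F = ∣-antisym
  (lcm-least (1∣ k) (lcm-least ∣-refl (lcm-least ∣-refl (1∣ k))))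
  (∣-trans (m∣lcm[m,n] k _) (n∣lcm[m,n] 1 _))

∣lcmAll : ∀ {m} (S : Vector ℕ m) i → S i ∣ lcmAll S
∣lcmAll S Fin.zero    = m∣lcm[m,n] (S Fin.zero) _
∣lcmAll S (Fin.suc i) = ∣-trans (∣lcmAll (S ∘ Fin.suc) i) (n∣lcm[m,n] (S Fin.zero) _)

-- Multiplicities and differences in a finite Abelian group.

module MultisetProperties (G : AbelianGroup c ℓ) (n : ℕ) (ord : HasOrder G n) where

  open import Data.List.Base using ([]; _∷_)
  open import Data.List.Relation.Unary.AllPairs using ([]; _∷_)
  open ListProperties
  open Multisets G n ord
  open AbelianGroup G using (_∙_; _≉_)
  private module G = AbelianGroup G
  open AbelianGroupProperties G
    using (//-rightDividesˡ; //-rightDividesʳ)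
  open Membership setoid using (_∈_; _∉_)
  open Uniqueness setoid using (Unique)

  multiplicity-++ : ∀ x A B → multiplicity x (A ++ B) ≡ multiplicity x A + multiplicity x B
  multiplicity-++ x A B = trans (cong length (filter-++ (x ≈?_) A B)) (length-++ (filter (x ≈?_) A))

  multiplicity-concatMap : ∀ {i} {I : Set i} x (f : I → List Carrier) is →
    multiplicity x (concatMap f is) ≡ sumᴸ (map (multiplicity x ∘ f) is)
  multiplicity-concatMap x f []       = refl
  multiplicity-concatMap x f (i ∷ is) = trans
    (multiplicity-++ x (f i) _)
    (cong (multiplicity x (f i) +_) (multiplicity-concatMap x f is))

  ∉⇒multiplicity≡0 : ∀ {x} A → x ∉ A → multiplicity x A ≡ 0
  ∉⇒multiplicity≡0 {x} A x∉A = cong length (filter-none (x ≈?_) (¬Any⇒All¬ A x∉A))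

  ∈⇒multiplicity≥1 : ∀ {x A} → x ∈ A → 1 ≤ multiplicity x A
  ∈⇒multiplicity≥1 {x} = filter-some (x ≈?_)

  Unique⇒multiplicity≤1 : ∀ {A} → Unique A → ∀ x → multiplicity x A ≤ 1
  Unique⇒multiplicity≤1 []              x = z≤n
  Unique⇒multiplicity≤1 {a ∷ A} (a≉ ∷ A!) x with x ≈? a
  ... | no  x≉a = subst (λ B → length B ≤ 1) (sym (filter-reject (x ≈?_) x≉a))
                    (Unique⇒multiplicity≤1 A! x)
  ... | yes x≈a = ≤-reflexive (trans (cong length (filter-accept (x ≈?_) x≈a)) (cong suc
    (cong length
      (filter-none (x ≈?_) (All.map (λ a≉b x≈b → a≉b (G.trans (G.sym x≈a) x≈b)) a≉)))))

  multiplicity-replicate : ∀ x k b → multiplicity x (replicate k b) ≡ k * multiplicity x [ b ]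
  multiplicity-replicate x zero    b = refl
  multiplicity-replicate x (suc k) b = trans
    (multiplicity-++ x [ b ] (replicate k b))
    (cong (multiplicity x [ b ] +_) (multiplicity-replicate x k b))

  multiplicity-⊠ : ∀ x k B → multiplicity x (k ⊠ B) ≡ k * multiplicity x B
  multiplicity-⊠ x k []      = sym (*-zeroʳ k)
  multiplicity-⊠ x k (b ∷ B) = begin
    multiplicity x (replicate k b ++ k ⊠ B)
      ≡⟨ multiplicity-++ x (replicate k b) (k ⊠ B) ⟩
    multiplicity x (replicate k b) + multiplicity x (k ⊠ B)
      ≡⟨ cong₂ _+_ (multiplicity-replicate x k b) (multiplicity-⊠ x k B) ⟩
    k * multiplicity x [ b ] + k * multiplicity x B
      ≡⟨ *-distribˡ-+ k (multiplicity x [ b ]) (multiplicity x B) ⟨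
    k * (multiplicity x [ b ] + multiplicity x B)
      ≡⟨ cong (k *_) (multiplicity-++ x [ b ] B) ⟨
    k * multiplicity x (b ∷ B)  ∎
    where open ≡-Reasoning

  x≈a-b⇒x∙b≈a : ∀ {x a b} → x ≈ a - b → x ∙ b ≈ a
  x≈a-b⇒x∙b≈a {x} {a} {b} eq = G.trans (G.∙-congʳ eq) (//-rightDividesˡ b a)

  x∙b≈a⇒x≈a-b : ∀ {x a b} → x ∙ b ≈ a → x ≈ a - b
  x∙b≈a⇒x≈a-b {x} {a} {b} eq = G.trans (G.sym (//-rightDividesʳ b x)) (G.∙-congʳ eq)

  -- For fixed `a`, sending `b` to `a - b` is an involution, so `x ≈ a - b` exactly when
  -- `a - x ≈ b`.
  multiplicity-map[a-] : ∀ x a B → multiplicity x (map (a -_) B) ≡ multiplicity (a - x) B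
  multiplicity-map[a-] x a = length-filter-map _ _ (a -_)
    (λ b eq → G.sym (x∙b≈a⇒x≈a-b (G.trans (G.comm b x) (x≈a-b⇒x∙b≈a eq))))
    (λ b eq → x∙b≈a⇒x≈a-b (G.trans (G.comm x b) (x≈a-b⇒x∙b≈a (G.sym eq))))

  multiplicity-map[-b] : ∀ x b A → multiplicity x (map (_- b) A) ≡ multiplicity (x ∙ b) A
  multiplicity-map[-b] x b = length-filter-map _ _ (_- b)
    (λ _ → x≈a-b⇒x∙b≈a) (λ _ → x∙b≈a⇒x≈a-b)

  D-[b] : ∀ A b → D A [ b ] ≡ map (_- b) A
  D-[b] []      b = refl
  D-[b] (a ∷ A) b = cong (a - b ∷_) (D-[b] A b)

  multiplicity-D-∷ : ∀ x a A B →
    multiplicity x (D (a ∷ A) B) ≡ multiplicity (a - x) B + multiplicity x (D A B)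
  multiplicity-D-∷ x a A B = trans
    (multiplicity-++ x (map (a -_) B) (D A B))
    (cong (_+ multiplicity x (D A B)) (multiplicity-map[a-] x a B))

  multiplicity-D-++ : ∀ x A B C →
    multiplicity x (D A (B ++ C)) ≡ multiplicity x (D A B) + multiplicity x (D A C)
  multiplicity-D-++ x []      B C = refl
  multiplicity-D-++ x (a ∷ A) B C
    rewrite multiplicity-D-∷ x a A (B ++ C) | multiplicity-D-∷ x a A B | multiplicity-D-∷ x a A C
          | multiplicity-++ (a - x) B C | multiplicity-D-++ x A B C =
    solve 4 (λ b c d e → (b :+ c) :+ (d :+ e) := (b :+ d) :+ (c :+ e)) refl
      (multiplicity (a - x) B) (multiplicity (a - x) C)
      (multiplicity x (D A B)) (multiplicity x (D A C))
    where open +-*-Solver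

  multiplicity-++-D : ∀ x A B C →
    multiplicity x (D (A ++ B) C) ≡ multiplicity x (D A C) + multiplicity x (D B C)
  multiplicity-++-D x []      B C = refl
  multiplicity-++-D x (a ∷ A) B C
    rewrite multiplicity-D-∷ x a (A ++ B) C | multiplicity-D-∷ x a A C | multiplicity-++-D x A B C =
    sym (+-assoc (multiplicity (a - x) C) _ _)

  multiplicity-D-⊠ : ∀ x A k B → multiplicity x (D A (k ⊠ B)) ≡ k * multiplicity x (D A B)
  multiplicity-D-⊠ x []      k B = sym (*-zeroʳ k)
  multiplicity-D-⊠ x (a ∷ A) k B
    rewrite multiplicity-D-∷ x a A (k ⊠ B) | multiplicity-D-∷ x a A B
          | multiplicity-⊠ (a - x) k B | multiplicity-D-⊠ x A k B =
    sym (*-distribˡ-+ k (multiplicity (a - x) B) _)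

  -- The count of `x` is a sum, over `a` in `A`, of multiplicities of `a - x` in the second list,
  -- and each summand is monotone.
  multiplicity-D-mono : ∀ x A {B C} → B ⊑ C → multiplicity x (D A B) ≤ multiplicity x (D A C)
  multiplicity-D-mono x []      B⊑C = z≤n
  multiplicity-D-mono x (a ∷ A) {B} {C} B⊑C
    rewrite multiplicity-D-∷ x a A B | multiplicity-D-∷ x a A C =
    +-mono-≤ (B⊑C (a - x)) (multiplicity-D-mono x A B⊑C)

  -- A system of representatives for `_≈_`: the list form of "`U` is all of `G`", independent of
  -- order and of the chosen representatives.
  Transversal : List Carrier → Set c
  Transversal U = ∀ x → multiplicity x U ≡ 1

  Unique-covering⇒transversal : ∀ {U} → Unique U → (∀ x → x ∈ U) → Transversal U
  Unique-covering⇒transversal U! covers x =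
    ≤-antisym (Unique⇒multiplicity≤1 U! x) (∈⇒multiplicity≥1 (covers x))

  -- For given `a` and `x` exactly one `b` in the group solves `a - b ≈ x`, so each entry of `A`
  -- contributes 1.
  multiplicity-D-transversal : ∀ U → Transversal U → ∀ x A → multiplicity x (D A U) ≡ length A
  multiplicity-D-transversal U U₁ x []      = refl
  multiplicity-D-transversal U U₁ x (a ∷ A) = trans
    (multiplicity-D-∷ x a A U)
    (cong₂ _+_ (U₁ (a - x)) (multiplicity-D-transversal U U₁ x A))

  -- Here each entry of the second list contributes 1. As `D` recurses on its first argument, the
  -- head of the second is split off by `multiplicity-D-++`.
  multiplicity-transversal-D : ∀ U → Transversal U → ∀ x A → multiplicity x (D U A) ≡ length A
  multiplicity-transversal-D U U₁ x [] =
    cong (multiplicity x) (cartesianProductWith-zeroʳ _-_ U)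
  multiplicity-transversal-D U U₁ x (a ∷ A) = trans
    (multiplicity-D-++ x U [ a ] A)
    (cong₂ _+_
      (trans (cong (multiplicity x) (D-[b] U a))
             (trans (multiplicity-map[-b] x a U) (U₁ (x ∙ a))))
      (multiplicity-transversal-D U U₁ x A))

  elements : List Carrier
  elements = map (Inverse.to ord) (allFin n)

  ∈-elements : ∀ x → x ∈ elements
  ∈-elements x = Membershipₚ.∈-resp-≈ setoid (Inverse.strictlyInverseˡ ord x)
    (Any.map⁺ (Any.map (λ { refl → G.refl }) (∈ₚ.∈-allFin (Inverse.from ord x))))

  elements-transversal : Transversal elements
  elements-transversal = Unique-covering⇒transversal
    (Uniqueₚ.map⁺ (≡.setoid (Fin n)) setoid (Injection.injective (Inverse⇒Injection ord))
      (Unique≡ₚ.allFin⁺ n))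
    ∈-elements

  -- The length of a list is the multiplicity of `ε` in the differences of the whole group with it,
  -- so monotonicity of `D` turns the pointwise comparison into one of lengths.
  ⊑⇒length≤ : ∀ A B → A ⊑ B → length A ≤ length B
  ⊑⇒length≤ A B A⊑B = begin
    length A  ≡⟨ multiplicity-transversal-D elements elements-transversal ε A ⟨
    multiplicity ε (D elements A)  ≤⟨ multiplicity-D-mono ε elements A⊑B ⟩
    multiplicity ε (D elements B)  ≡⟨ multiplicity-transversal-D elements elements-transversal ε B ⟩
    length B  ∎
    where open ≤-Reasoning

  length-G∖0 : length G∖0 < n
  length-G∖0 = begin-strict
    length G∖0  <⟨ filter-notAll (λ x → ¬? (x ≈? ε)) elements
                     (Any.map (λ ε≈x x≉ε → x≉ε (G.sym ε≈x)) (∈-elements ε)) ⟩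
    length elements  ≡⟨ trans (length-map _ (allFin n)) (length-tabulate (λ i → i)) ⟩
    n  ∎
    where open ≤-Reasoning

  multiplicity-G∖0 : ∀ {x} → x ≉ ε → 1 ≤ multiplicity x G∖0
  multiplicity-G∖0 {x} x≉ε = ∈⇒multiplicity≥1
    (Membershipₚ.∈-filter⁺ setoid (λ x → ¬? (x ≈? ε)) (λ y≈z y≉ε z≈ε → y≉ε (G.trans y≈z z≈ε))
      (∈-elements x) x≉ε)

  -- The pairs left out have difference `ε`, so they never contribute to a nonzero `x`.
  multiplicity-internalDifferences : ∀ {x} → x ≉ ε → ∀ B →
    multiplicity x (internalDifferences B) ≡ multiplicity x (D B B)
  multiplicity-internalDifferences {x} x≉ε B = trans
    (length-filter-map-filter (λ (x , y) → ¬? (x ≈? y)) (x ≈?_) (uncurry _-_)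
      (λ (a , b) x≈a-b a≈b → x≉ε (G.trans x≈a-b (G.trans (G.∙-congʳ a≈b) (G.inverseʳ b))))
      (cartesianProduct B B))
    (cong (multiplicity x) (map-uncurry-cartesianProduct _-_ B B))

  -- Each size divides the lcm, so weighting brings all blocks to the same length, and the number of
  -- differences from `B i` to a weighted block depends on `i` alone.
  length-weighted : ∀ {m} (B : Fin m → List Carrier) nonempty j →
                    length (weighted B nonempty j) ≡ lcmAll (sizes B)
  length-weighted B nonempty j = trans
    (length-concatMap-replicate _ (B j))
    (m/n*n≡m {{nonempty j}} (∣lcmAll (sizes B) j))

  -- Counting from the order and the sizes alone, so it serves both the minimality of λ for the
  -- constructed family and the optimality against any other. If `μ ≤ k`, at most `k * (4 * k + 1)`
  -- places are available, and the differences exceed this by `k`, which is positive.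
  weightedExternalDifferences-1kk : ∀ {k} .{{_ : NonZero k}} → n ≡ 2 * (2 * k + 1) →
    (B : Fin 3 → List Carrier) (nonempty : ∀ i → NonZero (sizes B i)) →
    (∀ i → sizes B i ≡ 1kk k i) →
    ∀ μ → weightedExternalDifferences B nonempty ⊑ μ ⊠ G∖0 → k + 1 ≤ μ
  weightedExternalDifferences-1kk {k} n≡ B nonempty size μ W⊑ =
    ≮⇒≥ λ μ<k+1 → <-irrefl refl (begin-strict
      k * (4 * k + 1)  <⟨ m<m+n _ (>-nonZero⁻¹ k) ⟩
      k * (4 * k + 1) + k
        ≡⟨ solve 1 (λ k → k :* (con 4 :* k :+ con 1) :+ k :=
             con 1 :* k :+ (con 1 :* k :+ (k :* k :+ (k :* k :+ (k :* k :+ (k :* k :+ con 0))))))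
             refl k ⟩
      -- One summand for each ordered pair of distinct blocks: the size of the first block times
      -- `k`, the length of every weighted block.
      1 * k + (1 * k + (k * k + (k * k + (k * k + (k * k + 0)))))
        ≡⟨ lengthW ⟨
      length (weightedExternalDifferences B nonempty)  ≤⟨ ⊑⇒length≤ (weightedExternalDifferences B nonempty) (μ ⊠ G∖0) W⊑ ⟩
      length (μ ⊠ G∖0)  ≡⟨ length-concatMap-replicate μ G∖0 ⟩
      μ * length G∖0
        -- Both strict inequalities lose one: `μ < k + 1` becomes `μ ≤ k`, and a length below `n`,
        -- which is `4 * k + 2`, is at most `4 * k + 1`.
        ≤⟨ *-mono-≤ (s≤s⁻¹ (≤-trans μ<k+1 (≤-reflexive (+-comm k 1))))
                    (s≤s⁻¹ (≤-trans length-G∖0 (≤-reflexive n≡1+))) ⟩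
      k * (4 * k + 1)  ∎)
    where
    open ≤-Reasoning
    open +-*-Solver
    n≡1+ : n ≡ suc (4 * k + 1)
    n≡1+ = trans n≡ (solve 1 (λ k → con 2 :* (con 2 :* k :+ con 1) := con 1 :+ (con 4 :* k :+ con 1))
                       refl k)
    lengthD : ∀ i j → length (D (B i) (weighted B nonempty j)) ≡ 1kk k i * k
    lengthD i j = trans (length-cartesianProductWith _-_ (B i) _)
      (cong₂ _*_ (size i) (trans (length-weighted B nonempty j) (lcmAll-1kk (sizes B) size)))
    lengthW : length (weightedExternalDifferences B nonempty) ≡
              1 * k + (1 * k + (k * k + (k * k + (k * k + (k * k + 0)))))
    lengthW = trans
      (length-concatMap (λ (i , j) → D (B i) (weighted B nonempty j))
        offDiagonal)
      (cong₂ _+_ (lengthD 0F 1F) (cong₂ _+_ (lengthD 0F 2F) (cong₂ _+_ (lengthD 1F 0F)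
        (cong₂ _+_ (lengthD 1F 2F) (cong₂ _+_ (lengthD 2F 0F) (cong (_+ 0) (lengthD 2F 1F)))))))

-- The two layers of `ℤ₂× G`.

module Layers (G : AbelianGroup c ℓ) (n : ℕ) (ord : HasOrder G n) where

  open import Data.List.Base using ([]; _∷_)
  open AbelianGroup ℤ₂ using () renaming (_-_ to _-₂_)
  open Multisets G n ord
  private module G = AbelianGroup G
  module ℤ₂×G where
    open Multisets (ℤ₂× G) (2 * n) (ℤ₂×-order G ord) public
    open MultisetProperties (ℤ₂× G) (2 * n) (ℤ₂×-order G ord) public

  multiplicity-layer : ∀ p x A →
    ℤ₂×G.multiplicity (p , x) (map (p ,_) A) ≡ multiplicity x A
  multiplicity-layer p x =
    ListProperties.length-filter-map _ _ (p ,_) (λ _ → proj₂) (λ _ → refl ,_)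

  multiplicity-other-layer : ∀ {p q} → p ≢ q → ∀ x A →
    ℤ₂×G.multiplicity (p , x) (map (q ,_) A) ≡ 0
  multiplicity-other-layer p≢q x A = ℤ₂×G.∉⇒multiplicity≡0 (map (_ ,_) A) λ px∈ →
    p≢q (proj₁ (proj₂ (Any.satisfied (Any.map⁻ px∈))))

  -- Subtraction is componentwise, so all differences between two layers land in one layer. This
  -- reduces counts in the product to counts in `G`.
  D-layers : ∀ p q A B →
    ℤ₂×G.D (map (p ,_) A) (map (q ,_) B) ≡ map (p -₂ q ,_) (D A B)
  D-layers p q []      B = refl
  D-layers p q (a ∷ A) B = begin
    map ((p , a) ℤ₂×G.-_) (map (q ,_) B) ++ ℤ₂×G.D (map (p ,_) A) (map (q ,_) B)
      -- Both composites send `b` to `(p -₂ q , a - b)`: one `map-∘` fuses the left side, the other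
      -- splits the result again.
      ≡⟨ cong₂ _++_ (trans (sym (map-∘ B)) (map-∘ B)) (D-layers p q A B) ⟩
    map (p -₂ q ,_) (map (a -_) B) ++ map (p -₂ q ,_) (D A B)
      ≡⟨ map-++ (p -₂ q ,_) (map (a -_) B) (D A B) ⟨
    map (p -₂ q ,_) (D (a ∷ A) B)  ∎
    where open ≡-Reasoning

open import Data.Vec.Functional using (_∷_; [])

-- The matrix of difference counts between the blocks of the PDF.

module PDFProperties (G : AbelianGroup c ℓ) (n : ℕ) (ord : HasOrder G n) (k : ℕ)
  (E₁ E₂ : List (AbelianGroup.Carrier G))
  -- The large blocks have size `suc k`, so the index, one less, is `k` without truncated
  -- subtraction.
  (pdf : IsPDF G n ord (1 ∷ suc k ∷ suc k ∷ []) k ([ AbelianGroup.ε G ] ∷ E₁ ∷ E₂ ∷ []))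
  where

  open Multisets G n ord
  open MultisetProperties G n ord
  open AbelianGroup G using (_≉_)
  private module G = AbelianGroup G
  open AbelianGroupProperties G using (x∙y⁻¹≈ε⇒x≈y)
  open IsPDF pdf
  open DisjointNonemptySubsets subsets public

  E : Fin 3 → List Carrier
  E = [ ε ] ∷ E₁ ∷ E₂ ∷ []

  U : List Carrier
  U = [ ε ] ++ (E₁ ++ E₂)

  U-transversal : Transversal U
  U-transversal = Unique-covering⇒transversal
    (Uniqueₚ.++⁺ setoid (unique 0F)
      (Uniqueₚ.++⁺ setoid (unique 1F) (unique 2F) (disjoint 1F 2F λ ()))
      λ (v∈ε , v∈E) → case Membershipₚ.∈-++⁻ setoid E₁ v∈E of λ where
        (inj₁ v∈E₁) → disjoint 0F 1F (λ ()) (v∈ε , v∈E₁)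
        (inj₂ v∈E₂) → disjoint 0F 2F (λ ()) (v∈ε , v∈E₂))
    λ x → case covers x of λ where
      (0F , x∈) → Membershipₚ.∈-++⁺ˡ setoid x∈
      (1F , x∈) → Membershipₚ.∈-++⁺ʳ setoid [ ε ] (Membershipₚ.∈-++⁺ˡ setoid x∈)
      (2F , x∈) → Membershipₚ.∈-++⁺ʳ setoid [ ε ] (Membershipₚ.∈-++⁺ʳ setoid E₁ x∈)

  -- For each `x` a 3 by 3 matrix indexed by pairs of blocks; its row sums, column sums and trace
  -- are what the construction relies on.
  d : Carrier → Fin 3 → Fin 3 → ℕ
  d x i j = multiplicity x (D (E i) (E j))

  -- The second blocks together make up the transversal `U`, so the sum is the size of block `i` for
  -- every `x`, `ε` included.
  row : ∀ x i → d x i 0F + (d x i 1F + d x i 2F) ≡ (1 ∷ suc k ∷ suc k ∷ []) i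
  row x i = begin
    d x i 0F + (d x i 1F + d x i 2F)
      ≡⟨ cong (d x i 0F +_) (multiplicity-D-++ x (E i) E₁ E₂) ⟨
    d x i 0F + multiplicity x (D (E i) (E₁ ++ E₂))
      ≡⟨ multiplicity-D-++ x (E i) [ ε ] (E₁ ++ E₂) ⟨
    multiplicity x (D (E i) U)  ≡⟨ multiplicity-D-transversal U U-transversal x (E i) ⟩
    length (E i)  ≡⟨ size i ⟩
    (1 ∷ suc k ∷ suc k ∷ []) i  ∎
    where open ≡-Reasoning

  column : ∀ x j → d x 0F j + (d x 1F j + d x 2F j) ≡ (1 ∷ suc k ∷ suc k ∷ []) j
  column x j = begin
    d x 0F j + (d x 1F j + d x 2F j)
      ≡⟨ cong (d x 0F j +_) (multiplicity-++-D x E₁ E₂ (E j)) ⟨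
    d x 0F j + multiplicity x (D (E₁ ++ E₂) (E j))
      ≡⟨ multiplicity-++-D x [ ε ] (E₁ ++ E₂) (E j) ⟨
    multiplicity x (D U (E j))  ≡⟨ multiplicity-transversal-D U U-transversal x (E j) ⟩
    length (E j)  ≡⟨ size j ⟩
    (1 ∷ suc k ∷ suc k ∷ []) j  ∎
    where open ≡-Reasoning

  -- A difference equal to `ε` would put one element into two disjoint blocks.
  d[ε]≡0 : ∀ {x} → x ≈ ε → ∀ i j → i ≢ j → d x i j ≡ 0
  d[ε]≡0 {x} x≈ε i j i≢j = ∉⇒multiplicity≡0 (D (E i) (E j)) λ x∈D →
    let a , b , a∈ , b∈ , x≈a-b = Membershipₚ.∈-cartesianProductWith⁻ setoid setoid setoid
                                    _-_ (E i) (E j) x∈D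
        a≈b = x∙y⁻¹≈ε⇒x≈y a b (G.trans (G.sym x≈a-b) x≈ε)
    in disjoint i j i≢j (Membershipₚ.∈-resp-≈ setoid a≈b a∈ , b∈)

  -- The PDF condition, read as the trace of the matrix.
  diagonal : ∀ {x} → x ≉ ε → d x 0F 0F + (d x 1F 1F + (d x 2F 2F + 0)) ≡ k
  diagonal {x} x≉ε = begin
    d x 0F 0F + (d x 1F 1F + (d x 2F 2F + 0))
      ≡⟨ cong₂ _+_ (internal 0F) (cong₂ _+_ (internal 1F) (cong (_+ 0) (internal 2F))) ⟨
    _ ≡⟨ multiplicity-concatMap x (λ i → internalDifferences (E i)) (allFin 3) ⟨
    _ ≡⟨ differences x x≉ε ⟩
    k ∎
    where
    open ≡-Reasoning
    internal : ∀ i → multiplicity x (internalDifferences (E i)) ≡ d x i i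
    internal i = multiplicity-internalDifferences x≉ε (E i)

  d₀₀≡0 : ∀ {x} → x ≉ ε → d x 0F 0F ≡ 0
  d₀₀≡0 x≉ε = ∉⇒multiplicity≡0 (D [ ε ] [ ε ]) λ { (here x≈ε-ε) → x≉ε (G.trans x≈ε-ε (G.inverseʳ ε)) }

  -- Rows 1 and 2 add up to twice `suc k`. Column 0 takes 1 of this, as `d x 0F 0F` vanishes, and
  -- the diagonal takes `k`; the remaining `suc k` falls to the two entries between `E₁` and `E₂`.
  external : ∀ {x} → x ≉ ε → d x 1F 2F + d x 2F 1F ≡ suc k
  external {x} x≉ε = +-cancelˡ-≡ (suc k) _ _ (begin
    suc k + (d x 1F 2F + d x 2F 1F)
      ≡⟨ cong (_+ (d x 1F 2F + d x 2F 1F)) (cong₂ _+_ d₁₀+d₂₀≡1 d₁₁+d₂₂≡k) ⟨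
    (d x 1F 0F + d x 2F 0F) + (d x 1F 1F + d x 2F 2F) + (d x 1F 2F + d x 2F 1F)
      ≡⟨ solve 6 (λ a b c d e f → (a :+ d) :+ (b :+ f) :+ (c :+ e) :=
           (a :+ (b :+ c)) :+ (d :+ (e :+ f))) refl
           (d x 1F 0F) (d x 1F 1F) (d x 1F 2F) (d x 2F 0F) (d x 2F 1F) (d x 2F 2F) ⟩
    (d x 1F 0F + (d x 1F 1F + d x 1F 2F)) + (d x 2F 0F + (d x 2F 1F + d x 2F 2F))
      ≡⟨ cong₂ _+_ (row x 1F) (row x 2F) ⟩
    suc k + suc k  ∎)
    where
    open ≡-Reasoning
    open +-*-Solver
    d₁₀+d₂₀≡1 : d x 1F 0F + d x 2F 0F ≡ 1
    d₁₀+d₂₀≡1 = trans (cong (_+ (d x 1F 0F + d x 2F 0F)) (sym (d₀₀≡0 x≉ε))) (column x 0F)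
    d₁₁+d₂₂≡k : d x 1F 1F + d x 2F 2F ≡ k
    d₁₁+d₂₂≡k = trans
      (cong₂ _+_ (sym (d₀₀≡0 x≉ε)) (cong (d x 1F 1F +_) (sym (+-identityʳ _))))
      (diagonal x≉ε)

-- The family in `ℤ₂× G` and its weighted differences.

module Construction (G : AbelianGroup c ℓ) (n : ℕ) (ord : HasOrder G n) (k : ℕ)
  (E₁ E₂ : List (AbelianGroup.Carrier G))
  (pdf : IsPDF G n ord (1 ∷ suc k ∷ suc k ∷ []) k ([ AbelianGroup.ε G ] ∷ E₁ ∷ E₂ ∷ []))
  where

  open AbelianGroup ℤ₂ using () renaming (_-_ to _-₂_)
  open Multisets G n ord
  open MultisetProperties G n ord using (∉⇒multiplicity≡0)
  open PDFProperties G n ord k E₁ E₂ pdf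
  open Layers G n ord
  module P = AbelianGroup (ℤ₂× G)
  open Membership setoid using (_∈_)
  open Membership P.setoid using () renaming (_∈_ to _∈ᴾ_)

  W : Fin 3 → List P.Carrier
  W = [ (1ℙ , ε) ] ∷ map (0ℙ ,_) E₁ ∷ map (0ℙ ,_) E₂ ∷ []

  layer : Fin 3 → Parity
  layer = 1ℙ ∷ 0ℙ ∷ 0ℙ ∷ []

  -- A uniform view of the three blocks; it computes only once the index is known, hence the cases.
  W≡ : ∀ i → W i ≡ map (layer i ,_) (E i)
  W≡ 0F = refl
  W≡ 1F = refl
  W≡ 2F = refl

  sizeW : ∀ i → length (W i) ≡ (1 ∷ suc k ∷ suc k ∷ []) i
  sizeW i = trans (cong length (W≡ i)) (trans (length-map (layer i ,_) (E i)) (IsPDF.size pdf i))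

  W-proj₂ : ∀ {v} i → v ∈ᴾ W i → proj₂ v ∈ E i
  W-proj₂ i v∈ = Any.map proj₂ (Any.map⁻ (subst (_ ∈ᴾ_) (W≡ i) v∈))

  -- Everything is inherited from second coordinates, which run through the blocks of the PDF;
  -- `(1ℙ , ε)` projects to the block `{0}`.
  W-subsets : DisjointNonemptySubsets (ℤ₂× G) 3 W
  W-subsets = record
    { unique   = λ i → subst (Uniqueness.Unique P.setoid) (sym (W≡ i))
                         (Uniqueₚ.map⁺ setoid P.setoid proj₂ (unique i))
    ; disjoint = λ i j i≢j (v∈Wᵢ , v∈Wⱼ) → disjoint i j i≢j (W-proj₂ i v∈Wᵢ , W-proj₂ j v∈Wⱼ)
    ; nonempty = λ i → subst NonZero
                         (sym (trans (cong length (W≡ i)) (length-map (layer i ,_) (E i))))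
                         (nonempty i)
    }

  nonemptyW : ∀ i → NonZero (length (W i))
  nonemptyW = DisjointNonemptySubsets.nonempty W-subsets

  -- The quotients of the lcm `suc k` by the sizes `1`, `suc k`, `suc k`.
  weight : Fin 3 → ℕ
  weight = suc k ∷ 1 ∷ 1 ∷ []

  weight≡ : ∀ j → (lcmAll (ℤ₂×G.sizes W) / ℤ₂×G.sizes W j) {{nonemptyW j}} ≡ weight j
  weight≡ 0F = trans (quotient-cong {{nonemptyW 0F}} (lcmAll-1kk _ sizeW) (sizeW 0F)) (n/1≡n (suc k))
  weight≡ 1F = trans (quotient-cong {{nonemptyW 1F}} (lcmAll-1kk _ sizeW) (sizeW 1F)) (n/n≡1 (suc k))
  weight≡ 2F = trans (quotient-cong {{nonemptyW 2F}} (lcmAll-1kk _ sizeW) (sizeW 2F)) (n/n≡1 (suc k))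

  e : P.Carrier → Fin 3 → Fin 3 → ℕ
  e y i j = ℤ₂×G.multiplicity y (map (layer i -₂ layer j ,_) (D (E i) (E j)))

  multiplicity-block : ∀ y i j →
    ℤ₂×G.multiplicity y (ℤ₂×G.D (W i) (ℤ₂×G.weighted W nonemptyW j)) ≡ weight j * e y i j
  multiplicity-block y i j = begin
    ℤ₂×G.multiplicity y (ℤ₂×G.D (W i) (ℤ₂×G.weighted W nonemptyW j))
      ≡⟨ ℤ₂×G.multiplicity-D-⊠ y (W i) _ (W j) ⟩
    (lcmAll (ℤ₂×G.sizes W) / ℤ₂×G.sizes W j) {{nonemptyW j}} *
      ℤ₂×G.multiplicity y (ℤ₂×G.D (W i) (W j))
      ≡⟨ cong₂ _*_ (weight≡ j) (cong (ℤ₂×G.multiplicity y)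
           (trans (cong₂ ℤ₂×G.D (W≡ i) (W≡ j)) (D-layers (layer i) (layer j) (E i) (E j)))) ⟩
    weight j * e y i j  ∎
    where open ≡-Reasoning

  -- The blocks are grouped by layer: the first four counts belong to layer `1ℙ`, the last two to
  -- layer `0ℙ`. Only differences that subtract `(1ℙ , ε)` carry the weight `suc k`.
  external-multiplicity : ∀ y → ℤ₂×G.multiplicity y (ℤ₂×G.weightedExternalDifferences W nonemptyW) ≡
    e y 0F 1F + e y 0F 2F + (suc k * (e y 1F 0F + e y 2F 0F) + (e y 1F 2F + e y 2F 1F))
  external-multiplicity y = begin
    ℤ₂×G.multiplicity y (ℤ₂×G.weightedExternalDifferences W nonemptyW)
      ≡⟨ ℤ₂×G.multiplicity-concatMap y (λ (i , j) → ℤ₂×G.D (W i) (ℤ₂×G.weighted W nonemptyW j))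
           offDiagonal ⟩
    block 0F 1F + (block 0F 2F + (block 1F 0F + (block 1F 2F + (block 2F 0F + (block 2F 1F + 0)))))
      ≡⟨ cong₂ _+_ (block≡ 0F 1F) (cong₂ _+_ (block≡ 0F 2F) (cong₂ _+_ (block≡ 1F 0F)
           (cong₂ _+_ (block≡ 1F 2F) (cong₂ _+_ (block≡ 2F 0F) (cong (_+ 0) (block≡ 2F 1F)))))) ⟩
    1 * e y 0F 1F + (1 * e y 0F 2F + (suc k * e y 1F 0F + (1 * e y 1F 2F +
      (suc k * e y 2F 0F + (1 * e y 2F 1F + 0)))))
      ≡⟨ solve 7 (λ m a b c d f g →
           con 1 :* a :+ (con 1 :* b :+ (m :* c :+ (con 1 :* d :+ (m :* f :+ (con 1 :* g :+ con 0)))))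
           := a :+ b :+ (m :* (c :+ f) :+ (d :+ g))) refl
           (suc k) (e y 0F 1F) (e y 0F 2F) (e y 1F 0F) (e y 1F 2F) (e y 2F 0F) (e y 2F 1F) ⟩
    e y 0F 1F + e y 0F 2F + (suc k * (e y 1F 0F + e y 2F 0F) + (e y 1F 2F + e y 2F 1F))  ∎
    where
    open ≡-Reasoning
    open +-*-Solver
    block : Fin 3 → Fin 3 → ℕ
    block i j = ℤ₂×G.multiplicity y (ℤ₂×G.D (W i) (ℤ₂×G.weighted W nonemptyW j))
    block≡ : ∀ i j → block i j ≡ weight j * e y i j
    block≡ = multiplicity-block y

  external-0ℙ : ∀ x →
    ℤ₂×G.multiplicity (0ℙ , x) (ℤ₂×G.weightedExternalDifferences W nonemptyW) ≡
    d x 1F 2F + d x 2F 1F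
  external-0ℙ x = begin
    _ ≡⟨ external-multiplicity y ⟩
    _ ≡⟨ cong₂ _+_ (cong₂ _+_ (off (λ ()) 0F 1F) (off (λ ()) 0F 2F))
           (cong₂ _+_ (cong (suc k *_) (cong₂ _+_ (off (λ ()) 1F 0F) (off (λ ()) 2F 0F)))
                      (cong₂ _+_ (multiplicity-layer 0ℙ x (D E₁ E₂))
                                 (multiplicity-layer 0ℙ x (D E₂ E₁)))) ⟩
    suc k * 0 + (d x 1F 2F + d x 2F 1F)  ≡⟨ cong (_+ (d x 1F 2F + d x 2F 1F)) (*-zeroʳ (suc k)) ⟩
    d x 1F 2F + d x 2F 1F  ∎
    where
    open ≡-Reasoning
    y = (0ℙ , x)
    off : ∀ {q} → 0ℙ ≢ q → ∀ i j → ℤ₂×G.multiplicity y (map (q ,_) (D (E i) (E j))) ≡ 0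
    off ≢q i j = multiplicity-other-layer ≢q x (D (E i) (E j))

  external-1ℙ : ∀ x →
    ℤ₂×G.multiplicity (1ℙ , x) (ℤ₂×G.weightedExternalDifferences W nonemptyW) ≡
    d x 0F 1F + d x 0F 2F + suc k * (d x 1F 0F + d x 2F 0F)
  external-1ℙ x = begin
    _ ≡⟨ external-multiplicity y ⟩
    _ ≡⟨ cong₂ _+_ (cong₂ _+_ (on 0F 1F) (on 0F 2F))
           (cong₂ _+_ (cong (suc k *_) (cong₂ _+_ (on 1F 0F) (on 2F 0F)))
                      (cong₂ _+_ (multiplicity-other-layer (λ ()) x (D E₁ E₂))
                                 (multiplicity-other-layer (λ ()) x (D E₂ E₁)))) ⟩
    d x 0F 1F + d x 0F 2F + (suc k * (d x 1F 0F + d x 2F 0F) + 0)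
      ≡⟨ cong (d x 0F 1F + d x 0F 2F +_) (+-identityʳ _) ⟩
    d x 0F 1F + d x 0F 2F + suc k * (d x 1F 0F + d x 2F 0F)  ∎
    where
    open ≡-Reasoning
    y = (1ℙ , x)
    on : ∀ i j → ℤ₂×G.multiplicity y (map (1ℙ ,_) (D (E i) (E j))) ≡ d x i j
    on i j = multiplicity-layer 1ℙ x (D (E i) (E j))

  external≤k+1 : ∀ y → ¬ y P.≈ P.ε →
    ℤ₂×G.multiplicity y (ℤ₂×G.weightedExternalDifferences W nonemptyW) ≤ suc k + 1
  external≤k+1 (0ℙ , x) y≉ε = begin
    _  ≡⟨ external-0ℙ x ⟩
    d x 1F 2F + d x 2F 1F  ≡⟨ external (λ x≈ε → y≉ε (refl , x≈ε)) ⟩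
    suc k  ≤⟨ m≤m+n (suc k) 1 ⟩
    suc k + 1  ∎
    where open ≤-Reasoning
  external≤k+1 (1ℙ , x) y≉ε = begin
    _  ≡⟨ external-1ℙ x ⟩
    d x 0F 1F + d x 0F 2F + suc k * (d x 1F 0F + d x 2F 0F)
      -- Row 0 and column 0 both sum to 1; dropping `d x 0F 0F` leaves at most 1 in each. In this
      -- layer `x` may be `ε`, where the dropped entry is not zero.
      ≤⟨ +-mono-≤ (m+n≤o⇒n≤o (d x 0F 0F) (≤-reflexive (row x 0F)))
                  (*-monoʳ-≤ (suc k) (m+n≤o⇒n≤o (d x 0F 0F) (≤-reflexive (column x 0F)))) ⟩
    1 + suc k * 1  ≡⟨ trans (cong suc (*-identityʳ (suc k))) (+-comm 1 (suc k)) ⟩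
    suc k + 1  ∎
    where open ≤-Reasoning

  -- The identity lies in layer `0ℙ`, whose only differences are those between the disjoint `E₁` and
  -- `E₂`.
  external[ε]≡0 : ∀ y → y P.≈ P.ε →
    ℤ₂×G.multiplicity y (ℤ₂×G.weightedExternalDifferences W nonemptyW) ≡ 0
  external[ε]≡0 (_ , x) (refl , x≈ε) = trans (external-0ℙ x)
    (cong₂ _+_ (d[ε]≡0 x≈ε 1F 2F λ ()) (d[ε]≡0 x≈ε 2F 1F λ ()))

  W-bound : ℤ₂×G.weightedExternalDifferences W nonemptyW ℤ₂×G.⊑ (suc k + 1) ℤ₂×G.⊠ ℤ₂×G.G∖0
  W-bound y with y ℤ₂×G.≈? P.ε
  -- The nonzero elements omit the identity, so the left-hand count has to be exactly 0 here.
  ... | yes y≈ε = subst (_≤ _) (sym (external[ε]≡0 y y≈ε)) z≤n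
  ... | no  y≉ε = begin
    _  ≤⟨ external≤k+1 y y≉ε ⟩
    suc k + 1  ≡⟨ *-identityʳ (suc k + 1) ⟨
    (suc k + 1) * 1  ≤⟨ *-monoʳ-≤ (suc k + 1) (ℤ₂×G.multiplicity-G∖0 y≉ε) ⟩
    (suc k + 1) * ℤ₂×G.multiplicity y ℤ₂×G.G∖0  ≡⟨ ℤ₂×G.multiplicity-⊠ y (suc k + 1) ℤ₂×G.G∖0 ⟨
    ℤ₂×G.multiplicity y ((suc k + 1) ℤ₂×G.⊠ ℤ₂×G.G∖0)  ∎
    where open ≤-Reasoning

theorem4 : ∀ {c ℓ} (k n₁ : ℕ) → k ≥ 1 → n₁ ≡ 2 * k + 1 →
    (G : AbelianGroup c ℓ) (ord : HasOrder G n₁)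
    (E₁ E₂ : List (AbelianGroup.Carrier G)) →
    IsPDF G n₁ ord (1 ∷ k ∷ k ∷ []) (k ∸ 1)
    ([ AbelianGroup.ε G ] ∷ E₁ ∷ E₂ ∷ []) →
    IsOptimalBSWEDF (ℤ₂× G) (2 * n₁) (ℤ₂×-order G ord) 3 (1 ∷ k ∷ k ∷ []) (2 * k + 1) (k + 1)
    ([ (1ℙ , AbelianGroup.ε G) ] ∷ map (0ℙ ,_) E₁ ∷ map (0ℙ ,_) E₂ ∷ [])
-- `k ≥ 1` excludes zero, and at a successor `k ∸ 1` reduces to the index that `Construction`
-- expects.
theorem4 (suc k) n₁ k≥1 n₁≡ G ord E₁ E₂ pdf = record
  { isBSWEDF = record
    { subsets  = W-subsets
    ; size     = sizeW
    ; total    = solve 1 (λ k → con 2 :* k :+ con 1 := con 1 :+ (k :+ (k :+ con 0))) refl (suc k)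
    ; positive = s≤s z≤n
    ; bound    = W-bound
    ; smallest = λ μ _ → MultisetProperties.weightedExternalDifferences-1kk (ℤ₂× G) (2 * n₁)
                   (ℤ₂×-order G ord) 2n₁≡ W nonemptyW sizeW μ
    }
  -- The counting bound again, now in an arbitrary `H` of the same order, fed with the sizes and the
  -- `bound` of the competing family.
  ; optimal = λ H ordH C a′ μ bswedf → let open IsBSWEDF bswedf in
      MultisetProperties.weightedExternalDifferences-1kk H (2 * n₁) ordH
        2n₁≡ C nonempty size μ bound
  }
  where
  open Construction G n₁ ord k E₁ E₂ pdf
  open +-*-Solver
  2n₁≡ : 2 * n₁ ≡ 2 * (2 * suc k + 1)
  2n₁≡ = cong (2 *_) n₁≡
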